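{- Let $\mathcal{G}=(V,E,\lambda)$ be a happy compressed temporal graph with $|V|\ge 2$ that is temporally connected. Let $e\in E^+$ be an edge of smallest label among the edges of $E^+$. If the label of $e$ is unique (that is, $\lambda(f)\ne\lambda(e)$ for every $f\in E$ with $f\neq e$), then $e$ is a pivot edge.
   Context: A happy temporal graph is a triple $\mathcal{G}=(V,E,\lambda)$ where $(V,E)$ is a finite simple undirected graph (the footprint) and $\lambda:E\to\{1,2,3,\dots\}$ assigns a single time label to each edge, such that two distinct edges sharing an endpoint have different labels. It is compressed if for every edge $e$ with $\lambda(e)>1$ there is an edge $e'$ adjacent to $e$ with $\lambda(e')=\lambda(e)-1$. A temporal walk is a walk in the footprint along which edge labels are strictly increasing (so no edge is repeated). For a vertex $v$ and an edge $e$: $v\leadsto e$ means some temporal walk starts at $v$ and traverses $e$; $e\leadsto v$ means some temporal walk traverses $e$ and ends at $v$ (edges may be traversed in either direction). $\mathcal{G}$ is temporally connected if for all distinct $u,v\in V$ there is a temporal walk from $u$ to $v$. For a vertex $v$, $e^+(v)$ is the edge incident to $v$ with the largest label, and $E^+=\{e^+(v):v\in V\}$. A pivot edge is an edge $e$ such that $v\leadsto e$ and $e\leadsto v$ for all $v\in V$. -}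

module Defs where

open import Data.Nat using (ℕ; suc; _≤_; _<_)
open import Data.Fin using (Fin)
open import Data.List using (List; []; _∷_)
open import Data.List.Membership.Propositional using (_∈_)
open import Data.List.Relation.Unary.Linked using (Linked)
open import Data.Product using (_×_; ∃-syntax; Σ-syntax)
open import Data.Sum using (_⊎_)
open import Relation.Binary.PropositionalEquality using (_≡_; _≢_)

-- The vertices are numbered by Fin order and the edges by Fin size. An edge
-- stores its two endpoints in an arbitrary order which carries no meaning:
-- every notion below is symmetric in end₁ and end₂.
record SimpleGraph : Set where
  field
    order : ℕ
    size  : ℕ

  Vertex : Set
  Vertex = Fin order

  Edge : Set
  Edge = Fin size

  field
    end₁ end₂ : Edge → Vertex

  Joins : Edge → Vertex → Vertex → Set
  Joins e u v = (end₁ e ≡ u × end₂ e ≡ v) ⊎ (end₁ e ≡ v × end₂ e ≡ u)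

  Incident : Vertex → Edge → Set
  Incident v e = v ≡ end₁ e ⊎ v ≡ end₂ e

  field
    loopless   : ∀ e → end₁ e ≢ end₂ e
    noParallel : ∀ e f u v → Joins e u v → Joins f u v → e ≡ f

  Adjacent : Edge → Edge → Set
  Adjacent e f = e ≢ f × (∃[ v ] (Incident v e × Incident v f))

  data Walk : Vertex → Vertex → Set where
    stop : ∀ {v} → Walk v v
    step : ∀ {u v w} (e : Edge) → Joins e u v → Walk v w → Walk u w

  edges : ∀ {u v} → Walk u v → List Edge
  edges stop         = []
  edges (step e _ p) = e ∷ edges p

record HappyTemporalGraph : Set where
  field
    footprint : SimpleGraph

  open SimpleGraph footprint public

  field
    label         : Edge → ℕ
    labelPositive : ∀ e → 1 ≤ label e
    happy         : ∀ e f → Adjacent e f → label e ≢ label f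

  Compressed : Set
  Compressed = ∀ e → 1 < label e → ∃[ e′ ] (Adjacent e′ e × label e ≡ suc (label e′))

  IsTemporal : ∀ {u v} → Walk u v → Set
  IsTemporal p = Linked (λ e f → label e < label f) (edges p)

  TemporalWalk : Vertex → Vertex → Set
  TemporalWalk u v = Σ[ p ∈ Walk u v ] IsTemporal p

  TemporallyConnected : Set
  TemporallyConnected = ∀ u v → u ≢ v → TemporalWalk u v

  VertexReachesEdge : Vertex → Edge → Set
  VertexReachesEdge v e = ∃[ w ] Σ[ p ∈ Walk v w ] (IsTemporal p × e ∈ edges p)

  EdgeReachesVertex : Edge → Vertex → Set
  EdgeReachesVertex e v = ∃[ u ] Σ[ p ∈ Walk u v ] (IsTemporal p × e ∈ edges p)

  -- "e = e⁺(v)". Given as a relation because e⁺(v) is undefined at an isolated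
  -- vertex; by happy, at most one edge e satisfies it for each v.
  IsLastEdgeAt : Vertex → Edge → Set
  IsLastEdgeAt v e = Incident v e × (∀ f → Incident v f → label f ≤ label e)

  InE⁺ : Edge → Set
  InE⁺ e = ∃[ v ] IsLastEdgeAt v e

  SmallestInE⁺ : Edge → Set
  SmallestInE⁺ e = InE⁺ e × (∀ f → InE⁺ f → label e ≤ label f)

  UniqueLabel : Edge → Set
  UniqueLabel e = ∀ f → f ≢ e → label f ≢ label e

  Pivot : Edge → Set
  Pivot e = ∀ v → VertexReachesEdge v e × EdgeReachesVertex e v

{-# OPTIONS --safe #-}
-- Let e = e⁺(w). A temporal walk arriving at w ends with a label at most λ(e),
-- so it either traverses e or can be extended by e; hence every vertex reaches e.
-- Conversely, every vertex v lies on an edge e⁺(v) with λ(e⁺(v)) ≥ λ(e).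
-- Compression gives a descending chain of adjacent edges, with consecutive
-- labels, from e⁺(v) to label λ(e), which by uniqueness ends in e itself.
-- Read backwards, and skipping edges where the chain stays at one vertex, it is
-- a temporal walk from e to v.
module Submission where

open import Defs
open import Data.Nat using (ℕ; zero; suc; _+_; _≤_; _<_; s≤s)
open import Data.Nat.Properties
  using (≤-refl; ≤-reflexive; ≤-trans; ≤-totalOrder; <-trans; ≤∧≢⇒<; m≤n⇒m≤1+n; n≤1+n;
         m≤n+m; m∸n+n≡m; suc-injective)
open import Data.Fin using (Fin; zero; suc; _≟_)
open import Data.List using (List; []; _∷_; _++_; [_]; allFin; filter)
open import Data.List.Extrema ≤-totalOrder using (argmax; argmax-all; f[xs]≤f[argmax])
open import Data.List.Membership.Propositional using (_∈_)
open import Data.List.Membership.Propositional.Properties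
  using (∈-allFin; ∈-filter⁺; ∈-++⁺ˡ; ∈-++⁺ʳ)
open import Data.List.Relation.Unary.All as All using (All; []; _∷_)
open import Data.List.Relation.Unary.All.Properties using (all-filter; ++⁺)
open import Data.List.Relation.Unary.Any using (here; there)
open import Data.List.Relation.Unary.Linked using (Linked; []; [-]; _∷_)
open import Data.Product using (_×_; _,_; ∃-syntax; Σ-syntax)
open import Data.Sum using (_⊎_; inj₁; inj₂; swap)
open import Relation.Binary.Core using (Rel)
open import Relation.Binary.PropositionalEquality
  using (_≡_; _≢_; refl; sym; trans; cong; subst)
open import Relation.Nullary using (Dec; yes; no; contradiction)
open import Relation.Nullary.Decidable using (_⊎-dec_)

Linked-∷ʳ⁺ : ∀ {a ℓ} {A : Set a} {R : Rel A ℓ} {xs : List A} {y : A} →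
             Linked R xs → All (λ x → R x y) xs → Linked R (xs ++ [ y ])
Linked-∷ʳ⁺ []       []         = [-]
Linked-∷ʳ⁺ [-]      (r ∷ [])   = r ∷ [-]
Linked-∷ʳ⁺ (r ∷ rs) (_ ∷ rest) = r ∷ Linked-∷ʳ⁺ rs rest

∃-distinct : ∀ {n} → 2 ≤ n → (i : Fin n) → ∃[ j ] i ≢ j
∃-distinct (s≤s (s≤s _)) zero    = suc zero , λ ()
∃-distinct (s≤s (s≤s _)) (suc _) = zero , λ ()

module GraphProperties (G : SimpleGraph) where
  open SimpleGraph G

  Joins-sym : ∀ {e u v} → Joins e u v → Joins e v u
  Joins-sym = swap

  Joins⇒Incidentˡ : ∀ {e u v} → Joins e u v → Incident u e
  Joins⇒Incidentˡ (inj₁ (p , _)) = inj₁ (sym p)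
  Joins⇒Incidentˡ (inj₂ (_ , q)) = inj₂ (sym q)

  otherEnd : ∀ {v e} → Incident v e → ∃[ u ] Joins e v u
  otherEnd {e = e} (inj₁ p) = end₂ e , inj₁ (sym p , refl)
  otherEnd {e = e} (inj₂ p) = end₁ e , inj₂ (refl , sym p)

  Incident⇒≡⊎Joins : ∀ {u v e} → Incident u e → Incident v e → u ≡ v ⊎ Joins e u v
  Incident⇒≡⊎Joins (inj₁ p) (inj₁ q) = inj₁ (trans p (sym q))
  Incident⇒≡⊎Joins (inj₁ p) (inj₂ q) = inj₂ (inj₁ (sym p , sym q))
  Incident⇒≡⊎Joins (inj₂ p) (inj₁ q) = inj₂ (inj₂ (sym q , sym p))
  Incident⇒≡⊎Joins (inj₂ p) (inj₂ q) = inj₁ (trans p (sym q))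

  incident? : ∀ v e → Dec (Incident v e)
  incident? v e = (v ≟ end₁ e) ⊎-dec (v ≟ end₂ e)

  snoc : ∀ {u v w} → Walk u v → (e : Edge) → Joins e v w → Walk u w
  snoc stop         e j = step e j stop
  snoc (step f i p) e j = step f i (snoc p e j)

  edges-snoc : ∀ {u v w} (p : Walk u v) (e : Edge) (j : Joins e v w) →
               edges (snoc p e j) ≡ edges p ++ [ e ]
  edges-snoc stop         e j = refl
  edges-snoc (step f i p) e j = cong (f ∷_) (edges-snoc p e j)

  walk⇒incidentEdge : ∀ {u v} → u ≢ v → Walk u v → ∃[ e ] Incident u e
  walk⇒incidentEdge u≢v stop         = contradiction refl u≢v
  walk⇒incidentEdge _   (step e j _) = e , Joins⇒Incidentˡ j

module TemporalProperties (G : HappyTemporalGraph) where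
  open HappyTemporalGraph G
  open GraphProperties footprint

  snoc-temporal : ∀ {u v w} (p : Walk u v) {e} (j : Joins e v w) → IsTemporal p →
                  All (λ f → label f < label e) (edges p) → IsTemporal (snoc p e j)
  snoc-temporal p {e} j t below rewrite edges-snoc p e j = Linked-∷ʳ⁺ t below

  ∃-lastEdgeAt : ∀ {v f} → Incident v f → ∃[ e ] IsLastEdgeAt v e
  ∃-lastEdgeAt {v} {f} vf =
      -- The default value `f` is itself incident to `v`, so the edge returned is incident to `v` in
      -- every case.
      argmax label f incidentEdges
    , argmax-all label vf (all-filter (incident? v) (allFin size))
    , λ g vg → All.lookup (f[xs]≤f[argmax] f incidentEdges)
                          (∈-filter⁺ (incident? v) (∈-allFin g) vg)
    where
    incidentEdges : List Edge
    incidentEdges = filter (incident? v) (allFin size)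

  uniqueLabel⇒≡ : ∀ {e f} → UniqueLabel e → label f ≡ label e → f ≡ e
  uniqueLabel⇒≡ {e} {f} unique eq with f ≟ e
  ... | yes f≡e = f≡e
  ... | no  f≢e = contradiction eq (unique f f≢e)

  -- Only the final edge of the walk needs an argument: it is incident to `w`, so maximality bounds
  -- its label, and uniqueness makes the bound strict unless it is `e`. Increasing labels carry the
  -- bound back to all earlier edges.
  traversesOrBelow : ∀ {w e} → IsLastEdgeAt w e → UniqueLabel e →
                     ∀ {u} (p : Walk u w) → IsTemporal p →
                     e ∈ edges p ⊎ All (λ f → label f < label e) (edges p)
  traversesOrBelow last unique stop _ = inj₂ []
  traversesOrBelow {e = e} (_ , maximal) unique (step f j stop) _ with f ≟ e
  ... | yes f≡e = inj₁ (here (sym f≡e))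
  ... | no  f≢e =
    inj₂ (≤∧≢⇒< (maximal f (Joins⇒Incidentˡ (Joins-sym j))) (unique f f≢e) ∷ [])
  traversesOrBelow last unique (step f j p@(step _ _ _)) (f<g ∷ t)
    with traversesOrBelow last unique p t
  ... | inj₁ e∈p           = inj₁ (there e∈p)
  ... | inj₂ (g<e ∷ below) = inj₂ (<-trans f<g g<e ∷ g<e ∷ below)

  vertexReachesLastEdge : TemporallyConnected → ∀ {w e} → IsLastEdgeAt w e → UniqueLabel e →
                          ∀ v → VertexReachesEdge v e
  vertexReachesLastEdge connected {w} {e} last@(we , _) unique v
    with otherEnd we | v ≟ w
  -- Connectedness speaks of distinct vertices only; from `w` itself, crossing `e` suffices.
  ... | x , j | yes refl = x , step e j stop , [-] , here refl
  ... | x , j | no v≢w with connected v w v≢w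
  ...   | p , t with traversesOrBelow last unique p t
  ...     | inj₁ e∈p   = w , p , t , e∈p
  ...     | inj₂ below = x , snoc p e j , snoc-temporal p j t below
                       , subst (e ∈_) (sym (edges-snoc p e j)) (∈-++⁺ʳ (edges p) (here refl))

  -- The bound `n` is the induction invariant: it lets the walk be prolonged by any edge labelled
  -- `suc n` at its end.
  ReachesBy : Edge → Vertex → ℕ → Set
  ReachesBy e v n = ∃[ u ] Σ[ p ∈ Walk u v ]
    (IsTemporal p × e ∈ edges p × All (λ f → label f ≤ n) (edges p))

  ReachesBy-mono : ∀ {e v m n} → m ≤ n → ReachesBy e v m → ReachesBy e v n
  ReachesBy-mono m≤n (u , p , t , e∈p , bound) =
    u , p , t , e∈p , All.map (λ l → ≤-trans l m≤n) bound

  ReachesBy-snoc : ∀ {e f v w n} → label f ≡ suc n → Joins f v w →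
                   ReachesBy e v n → ReachesBy e w (suc n)
  ReachesBy-snoc {e} {f} {n = n} f≡1+n j (u , p , t , e∈p , bound) =
      u , snoc p f j
    , snoc-temporal p j t
        (All.map (λ l → ≤-trans (s≤s l) (≤-reflexive (sym f≡1+n))) bound)
    , subst (e ∈_) (sym (edges-snoc p f j)) (∈-++⁺ˡ e∈p)
    , subst (All (λ g → label g ≤ suc n)) (sym (edges-snoc p f j))
        (++⁺ (All.map m≤n⇒m≤1+n bound) (≤-reflexive f≡1+n ∷ []))

  -- Induction on the label difference `d`. Both ends of `f` are covered because the next edge of
  -- the chain may be attached at either of them.
  reachesEndsOfLaterEdge : Compressed → ∀ {e} → UniqueLabel e →
                           ∀ d {f} → label f ≡ d + label e →
                           ∀ {v} → Incident v f → ReachesBy e v (d + label e)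
  reachesEndsOfLaterEdge compressed {e} unique zero eq vf
    with refl ← uniqueLabel⇒≡ unique eq | u , j ← otherEnd vf =
    u , step e (Joins-sym j) stop , [-] , here refl , ≤-refl ∷ []
  reachesEndsOfLaterEdge compressed {e} unique (suc d) {f} eq vf
    -- Since `label e` is positive, `label f` exceeds 1 and compression applies.
    with compressed f (subst (1 <_) (sym eq) (s≤s (≤-trans (labelPositive e) (m≤n+m _ d))))
  ... | f′ , (_ , c , cf′ , cf) , f≡1+f′
    with reachesEndsOfLaterEdge compressed unique d
           (suc-injective (trans (sym f≡1+f′) eq)) cf′
       | Incident⇒≡⊎Joins cf vf
  -- If `v` is the shared vertex `c`, then `f` is skipped and only the bound grows; otherwise the
  -- walk crosses `f` from `c` to `v`.
  ... | r | inj₁ refl = ReachesBy-mono (n≤1+n _) r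
  ... | r | inj₂ j    = ReachesBy-snoc eq j r

lemma3p29 : (G : HappyTemporalGraph) → let open HappyTemporalGraph G in
    2 ≤ order → Compressed → TemporallyConnected →
    (e : Edge) → SmallestInE⁺ e → UniqueLabel e → Pivot e
lemma3p29 G 2≤n compressed connected e ((w , last) , smallest) unique v =
  vertexReachesLastEdge connected last unique v , edgeReachesV
  where
  open HappyTemporalGraph G
  open GraphProperties footprint
  open TemporalProperties G

  edgeReachesV : EdgeReachesVertex e v
  edgeReachesV
    -- A walk from `v` to a second vertex begins with an edge at `v`, so `v` is not isolated and has
    -- a last edge `g`.
    with u , v≢u        ← ∃-distinct 2≤n v
    with p , _          ← connected v u v≢u
    with _ , vf         ← walk⇒incidentEdge v≢u p
    with g , g-last@(vg , _) ← ∃-lastEdgeAt vf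
    -- Minimality of `e` gives `label e ≤ label g`, so the truncated difference of the two labels is
    -- a true one and serves as `d`.
    with u , q , t , e∈q , _ ←
           reachesEndsOfLaterEdge compressed unique _
             (sym (m∸n+n≡m (smallest g (v , g-last)))) vg
    = u , q , t , e∈q
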